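{- If $S$ is an infinite meet-semilattice, then the lattice $Sub_\wedge(S)$ of meet-subsemilattices of $S$ (ordered by inclusion) contains a chain isomorphic to $\mathbb{Q}$. Consequently, $Sub_\wedge(S)$ is order-scattered if and only if $S$ is finite.
   Context: A poset is order-scattered if it contains no subset order-isomorphic to the chain $\mathbb{Q}$ of rationals. -}

module Defs where

open import Data.Fin.Properties using (≡-setoid)
open import Data.Nat using (ℕ)
open import Data.Product using (Σ; ∃; _×_; _,_; proj₁; proj₂)
open import Data.Rational using (ℚ)
open import Data.Rational.Properties using (≤-decTotalOrder)
open import Data.Sum using (inj₁; inj₂; [_,_])
open import Function using (Inverse; _∘_; id)
open import Level using (Level; _⊔_; suc; 0ℓ)
open import Relation.Binary using (Setoid; Poset; DecTotalOrder; _Respects_)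
open import Relation.Binary.Lattice using (MeetSemilattice; Lattice)
import Relation.Binary.Construct.On as On
open import Relation.Binary.Morphism.Structures using (IsOrderIsomorphism)
open import Relation.Nullary using (¬_)
open import Relation.Unary using (Pred; _∈_; _⊆_; _≐_; _∩_; _∪_)

private
  variable
    a b c ℓ₁ ℓ₂ ℓ₃ ℓ₄ : Level

Finite : Setoid a b → Set (a ⊔ b)
Finite S = Σ ℕ λ n → Inverse S (≡-setoid n)

Infinite : Setoid a b → Set (a ⊔ b)
Infinite S = ¬ Finite S

OrderIsomorphic : Poset a ℓ₁ ℓ₂ → Poset b ℓ₃ ℓ₄ → Set (a ⊔ b ⊔ ℓ₁ ⊔ ℓ₂ ⊔ ℓ₃ ⊔ ℓ₄)
OrderIsomorphic P Q =
  Σ (P.Carrier → Q.Carrier) (IsOrderIsomorphism P._≈_ Q._≈_ P._≤_ Q._≤_)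
  where
  module P = Poset P
  module Q = Poset Q

ℚ-poset : Poset 0ℓ 0ℓ 0ℓ
ℚ-poset = DecTotalOrder.poset ≤-decTotalOrder

subposet : (P : Poset a ℓ₁ ℓ₂) → Pred (Poset.Carrier P) b → Poset (a ⊔ b) ℓ₁ ℓ₂
subposet P X = On.poset {B = Σ (Poset.Carrier P) X} P proj₁

-- The subset is taken at the level of _≈_; this loses nothing, since the image
-- { y | ∃ q. f q ≈ y } of any f : ℚ → P already lives at that level.
ContainsChainℚ : Poset a ℓ₁ ℓ₂ → Set (a ⊔ suc ℓ₁ ⊔ ℓ₂)
ContainsChainℚ {ℓ₁ = ℓ₁} P =
  Σ (Pred P.Carrier ℓ₁) λ X → X Respects P._≈_ × OrderIsomorphic ℚ-poset (subposet P X)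
  where module P = Poset P

OrderScattered : Poset a ℓ₁ ℓ₂ → Set (a ⊔ suc ℓ₁ ⊔ ℓ₂)
OrderScattered P = ¬ ContainsChainℚ P

underlyingSetoid : MeetSemilattice c ℓ₁ ℓ₂ → Setoid c ℓ₁
underlyingSetoid S = Poset.Eq.setoid (MeetSemilattice.poset S)

module _ (S : MeetSemilattice c ℓ₁ ℓ₂) where
  private module S = MeetSemilattice S

  -- The empty subset is allowed, so that intersections always exist.
  record MeetSubsemilattice (p : Level) : Set (c ⊔ ℓ₁ ⊔ suc p) where
    field
      member   : Pred S.Carrier p
      resp     : member Respects S._≈_
      ∧-closed : ∀ {x y} → x ∈ member → y ∈ member → (x S.∧ y) ∈ member

  open MeetSubsemilattice

  data Generated {p} (X : Pred S.Carrier p) : Pred S.Carrier (c ⊔ ℓ₁ ⊔ p) where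
    incl : ∀ {x} → x ∈ X → Generated X x
    conv : ∀ {x y} → x S.≈ y → Generated X x → Generated X y
    meet : ∀ {x y} → Generated X x → Generated X y → Generated X (x S.∧ y)

  generated-least : ∀ {p q} {X : Pred S.Carrier p} (A : MeetSubsemilattice q) →
                    X ⊆ member A → Generated X ⊆ member A
  generated-least A X⊆A (incl x∈X)   = X⊆A x∈X
  generated-least A X⊆A (conv x≈y g) = resp A x≈y (generated-least A X⊆A g)
  generated-least A X⊆A (meet g h)   =
    ∧-closed A (generated-least A X⊆A g) (generated-least A X⊆A h)

  -- Subsets are predicates at level c ⊔ ℓ₁ ⊔ p, for p arbitrary: joins are
  -- generated subsemilattices, which quantify over S.Carrier and S._≈_.
  Sub∧ : (p : Level) → Lattice (suc (c ⊔ ℓ₁ ⊔ p)) (c ⊔ ℓ₁ ⊔ p) (c ⊔ ℓ₁ ⊔ p)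
  Sub∧ p = record
    { Carrier   = MeetSubsemilattice (c ⊔ ℓ₁ ⊔ p)
    ; _≈_       = λ A B → member A ≐ member B
    ; _≤_       = λ A B → member A ⊆ member B
    ; _∨_       = λ A B → record
      { member   = Generated (member A ∪ member B)
      ; resp     = conv
      ; ∧-closed = meet
      }
    ; _∧_       = λ A B → record
      { member   = member A ∩ member B
      ; resp     = λ x≈y (x∈A , x∈B) → resp A x≈y x∈A , resp B x≈y x∈B
      ; ∧-closed = λ (x∈A , x∈B) (y∈A , y∈B) → ∧-closed A x∈A y∈A , ∧-closed B x∈B y∈B
      }
    ; isLattice = record
      { isPartialOrder = record
        { isPreorder = record
          { isEquivalence = record
            { refl  = id , id
            ; sym   = λ (f , g) → g , f
            ; trans = λ (f , g) (h , k) → h ∘ f , g ∘ k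
            }
          ; reflexive = proj₁
          ; trans     = λ f g → g ∘ f
          }
        ; antisym = λ f g → f , g
        }
      ; supremum = λ A B →
          (λ x∈A → incl (inj₁ x∈A)) ,
          (λ x∈B → incl (inj₂ x∈B)) ,
          λ C A⊆C B⊆C → generated-least C [ A⊆C , B⊆C ]
      ; infimum  = λ A B → proj₁ , proj₂ , λ C C⊆A C⊆B x∈C → C⊆A x∈C , C⊆B x∈C
      }
    }

{-# OPTIONS --safe #-}

-- An independent sequence a : ℕ → S, one in which no term lies in the
-- subsemilattice generated by the others, embeds the inclusion order on subsets of ℕ
-- into Sub∧(S); hence ℚ embeds, by sending q to the subsemilattice generated by the
-- a m with e m < q, where e : ℕ → ℚ is onto.
--
-- An infinite S has an independent sequence.  Strictly descending and strictly
-- ascending sequences are independent.  If there are none, S has a least element,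
-- so some x is maximal among the elements with an infinite up-set.  Every y > x then has a
-- finite up-set, so each finite set of atoms over x misses the up-set of some y > x, and
-- an atom below y is new: there are infinitely many atoms over x.  Any two of them
-- meet in x, which makes an injective sequence of atoms independent.
--
-- Conversely, picking a new element at each of n + 1 successive steps of a chain in
-- Sub∧(S) gives n + 1 distinct elements, so ℚ does not embed if S has n elements.
module Submission where

open import Defs
open import Axiom.DoubleNegationElimination using (em⇒dne)
open import Axiom.ExcludedMiddle using (ExcludedMiddle)
open import Data.Fin using (Fin; toℕ) renaming (zero to fzero; suc to fsuc)
open import Data.Fin.Properties using (pigeonhole)
open import Data.Integer using (+_; -[1+_]; _⊖_; +≤+)
import Data.Integer.Properties as ℤ
open import Data.List using (List; []; _∷_; length; lookup; concatMap; deduplicate)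
open import Data.List.Membership.Propositional.Properties using (∈-lookup)
import Data.List.Membership.Setoid as Membership
import Data.List.Membership.Setoid.Properties as Membershipₚ
import Data.List.Relation.Unary.All as All
open import Data.List.Relation.Unary.AllPairs using (_∷_)
open import Data.List.Relation.Unary.Any using (here; there; index)
import Data.List.Relation.Unary.Any as Any
open import Data.List.Relation.Unary.Any.Properties using (lookup-index; concat⁺; map⁺)
import Data.List.Relation.Unary.Unique.Setoid as Unique
open import Data.List.Relation.Unary.Unique.DecSetoid.Properties using (deduplicate-!)
open import Data.Nat as ℕ using (ℕ; zero; suc; _+_; _<_; s≤s)
open import Data.Nat.Coprimality using (1-coprimeTo) renaming (sym to coprime-sym)
open import Data.Nat.GeneralisedArithmetic using (fold)
import Data.Nat.Properties as ℕ
open import Data.Product using (Σ; ∃; Σ-syntax; ∃-syntax; _×_; _,_; proj₁; proj₂; uncurry)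
open import Data.Rational as ℚ using (ℚ; mkℚ; *≤*)
import Data.Rational.Properties as ℚ
open import Data.Sum using (_⊎_; inj₁; inj₂; [_,_])
import Data.Sum as Sum
open import Function using (_⇔_; mk⇔; Inverse; Injective; _∘_; flip)
open import Level using (Level; _⊔_; Lift; lift; lower; 0ℓ)
open import Relation.Binary
  using (Setoid; DecSetoid; Poset; Rel; Decidable; Transitive; tri<; tri≈; tri>)
open import Relation.Binary.Lattice using (MeetSemilattice; module Lattice)
import Relation.Binary.Lattice.Properties.MeetSemilattice as MeetSemilatticeₚ
import Relation.Binary.Properties.Poset as Posetₚ
open import Relation.Binary.Morphism.Structures using (IsOrderIsomorphism)
open import Relation.Binary.PropositionalEquality
  using (_≡_; refl; sym; trans; cong; subst; module ≡-Reasoning)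
open import Relation.Nullary using (¬_; yes; no; contradiction)
open import Relation.Nullary.Decidable using (map′; decidable-stable)
open import Relation.Unary using (Pred; _∈_; _⊆_; U)

private
  variable
    a b c d r p q ℓ₁ ℓ₂ : Level

lower-em : ∀ b → ExcludedMiddle (a ⊔ b) → ExcludedMiddle a
lower-em b em = map′ lower lift (em {Lift b _})

-- The rationals

-- Successor in Cantor's enumeration by antidiagonals: along `m + n = s`, then on to `(s + 1 , 0)`.
next : ℕ × ℕ → ℕ × ℕ
next (zero  , n) = suc n , zero
next (suc m , n) = m , suc n

unpair : ℕ → ℕ × ℕ
unpair zero    = zero , zero
unpair (suc k) = next (unpair k)

unpair-surjective : ∀ m n → ∃[ k ] unpair k ≡ (m , n)
unpair-surjective m n = go (m + n) m n refl
  where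
  go : ∀ s m n → m + n ≡ s → ∃[ k ] unpair k ≡ (m , n)
  go s m (suc n) eq with k , e ← go s (suc m) n (trans (sym (ℕ.+-suc m n)) eq) =
    suc k , cong next e
  go zero zero zero eq = zero , refl
  go (suc s) (suc m) zero eq
    with k , e ← go s zero m (trans (sym (ℕ.+-identityʳ m)) (ℕ.suc-injective eq)) =
    suc k , cong next e

-- `i` codes the numerator as a difference of naturals, and `d` is the denominator minus one.
-- Unreduced fractions are harmless, since only surjectivity is wanted.
quotient : ℕ × ℕ → ℚ
quotient (i , d) = uncurry _⊖_ (unpair i) ℚ./ suc d

enumℚ : ℕ → ℚ
enumℚ = quotient ∘ unpair

⊖-surjective : ∀ z → ∃[ u ] ∃[ v ] u ⊖ v ≡ z
⊖-surjective (+ u)    = u , 0 , refl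
⊖-surjective -[1+ v ] = 0 , suc v , refl

enumℚ-surjective : ∀ x → ∃[ n ] enumℚ n ≡ x
enumℚ-surjective x@(mkℚ z d _)
  with u , v , u⊖v≡z ← ⊖-surjective z
  with i , unpair-i≡ ← unpair-surjective u v
  with n , unpair-n≡ ← unpair-surjective i d = n , (begin
  quotient (unpair n)              ≡⟨ cong quotient unpair-n≡ ⟩
  uncurry _⊖_ (unpair i) ℚ./ suc d ≡⟨ cong (λ uv → uncurry _⊖_ uv ℚ./ suc d) unpair-i≡ ⟩
  (u ⊖ v) ℚ./ suc d                ≡⟨ cong (ℚ._/ suc d) u⊖v≡z ⟩
  z ℚ./ suc d                      ≡⟨ ℚ.↥p/↧p≡p x ⟩
  x                                ∎)
  where open ≡-Reasoning

fromℕ : ℕ → ℚ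
fromℕ n = mkℚ (+ n) 0 (coprime-sym (1-coprimeTo n))

fromℕ-mono-≤ : ∀ {m n} → m ℕ.≤ n → fromℕ m ℚ.≤ fromℕ n
fromℕ-mono-≤ m≤n = *≤* (ℤ.*-monoʳ-≤-nonNeg (+ 1) (+≤+ m≤n))

fromℕ-cancel-≤ : ∀ {m n} → fromℕ m ℚ.≤ fromℕ n → m ℕ.≤ n
fromℕ-cancel-≤ {m} {n} (*≤* m≤n) = ℤ.drop‿+≤+ (ℤ.*-cancelʳ-≤-pos (+ m) (+ n) (+ 1) m≤n)

embedding⇒ContainsChainℚ : (P : Poset c ℓ₁ ℓ₂) (let module P = Poset P) (f : ℚ → P.Carrier) →
  (∀ {x y} → x ℚ.≤ y → f x P.≤ f y) → (∀ {x y} → f x P.≤ f y → x ℚ.≤ y) → ContainsChainℚ P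
embedding⇒ContainsChainℚ P f mono cancel =
  (λ y → ∃[ x ] f x P.≈ y) ,
  (λ y≈z (x , fx≈y) → x , P.Eq.trans fx≈y y≈z) ,
  (λ x → f x , x , P.Eq.refl) ,
  record
    { isOrderMonomorphism = record
      { isOrderHomomorphism = record
        { cong = λ where refl → P.Eq.refl
        ; mono = mono
        }
      ; injective = λ fx≈fy →
          ℚ.≤-antisym (cancel (P.reflexive fx≈fy)) (cancel (P.reflexive (P.Eq.sym fx≈fy)))
      ; cancel = cancel
      }
    ; surjective = λ (y , x , fx≈y) → x , λ where refl → fx≈y
    }
  where module P = Poset P

-- Finite and infinite sets

module _ (S : Setoid c ℓ₁) where
  open Setoid S using (Carrier; _≈_) renaming (sym to ≈-sym; trans to ≈-trans)
  open Membership S using (_∉_) renaming (_∈_ to _∈ₗ_)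
  open Unique S using (Unique)

  -- The list may repeat elements and leave `P`, so a concatenation of covers covers a union.
  Covered : Pred Carrier d → Set (c ⊔ ℓ₁ ⊔ d)
  Covered P = ∃[ xs ] P ⊆ (_∈ₗ xs)

  lookup-injective : ∀ {xs} → Unique xs → ∀ i j → lookup xs i ≈ lookup xs j → i ≡ j
  lookup-injective (_ ∷ _) fzero fzero _ = refl
  lookup-injective {xs = _ ∷ xs} (x≉ ∷ _) fzero (fsuc j) eq =
    contradiction eq (All.lookup x≉ (∈-lookup j))
  lookup-injective {xs = _ ∷ xs} (x≉ ∷ _) (fsuc i) fzero eq =
    contradiction (≈-sym eq) (All.lookup x≉ (∈-lookup i))
  lookup-injective (_ ∷ uniq) (fsuc i) (fsuc j) eq = cong fsuc (lookup-injective uniq i j eq)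

  covered⇒finite : Decidable _≈_ → Covered U → Finite S
  covered⇒finite _≟_ (xs , covers) = length ys , record
    { to        = to
    ; from      = lookup ys
    ; to-cong   = λ {x} {y} x≈y →
        injective (to x) (to y) (≈-trans (≈-sym (lookup-to x)) (≈-trans x≈y (lookup-to y)))
    ; from-cong = λ where refl → Setoid.refl S
    ; inverse   =
        (λ {i} {x} x≈yᵢ → injective (to x) i (≈-trans (≈-sym (lookup-to x)) x≈yᵢ)) ,
        (λ {x} → λ where refl → ≈-sym (lookup-to x))
    }
    where
    DS : DecSetoid c ℓ₁
    DS = record { isDecEquivalence = record { isEquivalence = Setoid.isEquivalence S ; _≟_ = _≟_ } }
    ys = deduplicate _≟_ xs
    injective = lookup-injective (deduplicate-! DS xs)
    member : ∀ x → x ∈ₗ ys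
    member x = Membershipₚ.∈-deduplicate⁺ S _≟_ (λ z≈y x≈y → ≈-trans x≈y (≈-sym z≈y)) (covers _)
    to : Carrier → Fin (length ys)
    to x = index (member x)
    lookup-to : ∀ x → x ≈ lookup ys (to x)
    lookup-to x = lookup-index (member x)

  <⇒≉⇒injective : (f : ℕ → Carrier) → (∀ {m n} → m < n → ¬ f m ≈ f n) → Injective _≡_ _≈_ f
  <⇒≉⇒injective f <⇒≉ {m} {n} fm≈fn with ℕ.<-cmp m n
  ... | tri< m<n _ _ = contradiction fm≈fn (<⇒≉ m<n)
  ... | tri≈ _ m≡n _ = m≡n
  ... | tri> _ _ n<m = contradiction (≈-sym fm≈fn) (<⇒≉ n<m)

  module _ {P : Pred Carrier d} (em : ExcludedMiddle (c ⊔ ℓ₁ ⊔ d)) (¬covered : ¬ Covered P) where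

    fresh : ∀ xs → ∃[ x ] P x × x ∉ xs
    fresh xs = em⇒dne em λ none →
      ¬covered (xs , λ Px → em⇒dne (lower-em d em) λ x∉xs → none (_ , Px , x∉xs))

    initial : ℕ → List Carrier
    initial zero    = []
    initial (suc n) = proj₁ (fresh (initial n)) ∷ initial n

    -- Each term is chosen outside the list `initial n` of all earlier terms.
    ¬covered⇒sequence : Σ[ f ∈ (ℕ → Carrier) ] (∀ n → P (f n)) × Injective _≡_ _≈_ f
    ¬covered⇒sequence = f , (λ n → proj₁ (proj₂ (fresh (initial n)))) ,
      <⇒≉⇒injective f λ {m} {n} m<n fm≈fn →
        proj₂ (proj₂ (fresh (initial n))) (Any.map (≈-trans (≈-sym fm≈fn)) (earlier m<n))
      where
      f : ℕ → Carrier
      f n = proj₁ (fresh (initial n))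
      earlier : ∀ {m n} → m < n → f m ∈ₗ initial n
      earlier {m} {suc n} (s≤s m≤n) with ℕ.m≤n⇒m<n∨m≡n m≤n
      ... | inj₁ m<n  = there (earlier m<n)
      ... | inj₂ refl = here (Setoid.refl S)

-- Extremal elements

Ascending : {A : Set c} → Rel A r → Pred (ℕ → A) r
Ascending R f = ∀ n → R (f n) (f (suc n))

ascending⇒< : {A : Set c} {R : Rel A r} → Transitive R → ∀ {f} → Ascending R f →
  ∀ {m n} → m < n → R (f m) (f n)
ascending⇒< {R = R} R-trans {f} step {n = suc n} (s≤s m≤n) with ℕ.m≤n⇒m<n∨m≡n m≤n
... | inj₁ m<n  = R-trans (ascending⇒< {R = R} R-trans {f} step m<n) (step n)
... | inj₂ refl = step n

-- A general `R` serves minimal elements too, through `flip _≺_`.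
Maximal : {A : Set c} → Rel A r → Pred A d → Pred A (c ⊔ r ⊔ d)
Maximal R D x = D x × ∀ {y} → D y → ¬ R x y

-- Excluded middle for types provides choice functions, hence dependent choice.
∃-maximal : {A : Set c} (R : Rel A r) (D : Pred A d) → ExcludedMiddle (c ⊔ r ⊔ d) →
  ¬ ∃ (Ascending R) → ∃ D → ∃ (Maximal R D)
∃-maximal R D em ¬ascending x₀ = em⇒dne em {P = ∃ (Maximal R D)} λ ¬maximal →
  let above : (x : ∃ D) → Σ[ y ∈ ∃ D ] R (proj₁ x) (proj₁ y)
      above (x , Dx) = em⇒dne em λ none →
        ¬maximal (x , Dx , λ Dy Rxy → none ((_ , Dy) , Rxy))
      walk : ℕ → ∃ D
      walk = fold x₀ (proj₁ ∘ above)
  in ¬ascending (proj₁ ∘ walk , proj₂ ∘ above ∘ walk)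

-- Independent sequences

module _ (S : MeetSemilattice c ℓ₁ ℓ₂) where
  open MeetSemilattice S renaming (trans to ≤-trans) hiding (refl)
  open MeetSemilatticeₚ S using (∧-comm; y≤x⇒x∧y≈y)
  open Posetₚ poset renaming (_<_ to _≺_)
  open MeetSubsemilattice
  private
    module ≈ = Setoid (underlyingSetoid S)

  -- `Lift` puts the generated subsemilattice at the level of the elements of `Sub∧ S p`.
  Terms : (ℕ → Carrier) → Pred ℕ 0ℓ → ∀ p → Pred Carrier (ℓ₁ ⊔ p)
  Terms f Y p x = Lift p (∃[ n ] Y n × f n ≈ x)

  -- The case where `Y` is the complement of `n` says that the other terms do not generate `f n`.
  -- Quantifying over all `Y` states this positively.
  Independent : ∀ p → Pred (ℕ → Carrier) (Level.suc 0ℓ ⊔ c ⊔ ℓ₁ ⊔ p)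
  Independent p f = ∀ Y n → f n ∈ Generated S (Terms f Y p) → Y n

  independent⇒ContainsChainℚ : ∀ {f} → Independent p f →
    ContainsChainℚ (Lattice.poset (Sub∧ S p))
  independent⇒ContainsChainℚ {p = p} {f} indep =
    embedding⇒ContainsChainℚ (Lattice.poset (Sub∧ S p)) span
    (λ x≤y → generated-least S (span _) λ where
      (lift (n , n<x , fn≈)) → incl (lift (n , ℚ.<-≤-trans n<x x≤y , fn≈)))
    -- If `y < x`, the term at an index of `y` lies in `span x` but, by independence and the strict
    -- inequality in `span`, not in `span y`.
    (λ {x} {y} span-x⊆span-y → ℚ.≮⇒≥ λ y<x →
      let n , enum-n≡y = enumℚ-surjective y
      in ℚ.<-irrefl enum-n≡y (indep _ n (span-x⊆span-y
           (incl (lift (n , subst (ℚ._< x) (sym enum-n≡y) y<x , ≈.refl))))))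
    where
    span : ℚ → MeetSubsemilattice S (c ⊔ ℓ₁ ⊔ p)
    span x = record
      { member   = Generated S (Terms f (λ n → enumℚ n ℚ.< x) p)
      ; resp     = conv
      ; ∧-closed = meet
      }

  -- The elements of `T` that equal `f n` only if `n` is in `Y` are closed under meets by
  -- irreducibility and contain the terms indexed by `Y` by injectivity. Irreducibility is asked
  -- only within `T`, which may be much smaller than `S`.
  irreducible⇒independent : ∀ {f} (T : MeetSubsemilattice S q) →
    (∀ n → f n ∈ member T) → Injective _≡_ _≈_ f →
    (∀ n {x y} → x ∈ member T → y ∈ member T → x ∧ y ≈ f n → x ≈ f n ⊎ y ≈ f n) →
    Independent p f
  irreducible⇒independent {f = f} T f∈T f-inj irreducible Y n fn∈ =
    proj₂ (generated-least S others terms fn∈) ≈.refl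
    where
    others : MeetSubsemilattice S _
    others = record
      { member   = λ x → x ∈ member T × (x ≈ f n → Y n)
      ; resp     = λ x≈y (x∈T , h) → resp T x≈y x∈T , λ y≈fn → h (≈.trans x≈y y≈fn)
      ; ∧-closed = λ (x∈T , h) (y∈T , k) →
          ∧-closed T x∈T y∈T , λ x∧y≈fn → [ h , k ] (irreducible n x∈T y∈T x∧y≈fn)
      }
    terms : Terms f Y _ ⊆ member others
    terms (lift (m , m∈Y , fm≈x)) =
      resp T fm≈x (f∈T m) , λ x≈fn → subst Y (f-inj (≈.trans fm≈x x≈fn)) m∈Y

  ≤⇒∧≈ˡ : ∀ {x y} → x ≤ y → x ∧ y ≈ x
  ≤⇒∧≈ˡ x≤y = ≈.trans (∧-comm _ _) (y≤x⇒x∧y≈y x≤y)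

  -- The meet of two comparable elements is one of them, so every term is irreducible among the
  -- terms. `R` stands for `_≺_` or its converse.
  chain⇒independent : {R : Rel Carrier r} → Transitive R → (∀ {x y} → R x y → ¬ x ≈ y) →
    (∀ {x y} → R x y → x ≤ y ⊎ y ≤ x) → ∀ {f} → Ascending R f → Independent p f
  chain⇒independent {R = R} R-trans R⇒≉ R⇒comparable {f} ascending =
    irreducible⇒independent terms (λ n → n , ≈.refl)
      (<⇒≉⇒injective (underlyingSetoid S) f (R⇒≉ ∘ increasing))
      λ n x∈ y∈ x∧y≈fn →
        Sum.map (λ e → ≈.trans (≈.sym e) x∧y≈fn) (λ e → ≈.trans (≈.sym e) x∧y≈fn) (∧-sel x∈ y∈)
    where
    increasing = ascending⇒< {R = R} R-trans ascending

    comparable : ∀ m n → f m ≤ f n ⊎ f n ≤ f m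
    comparable m n with ℕ.<-cmp m n
    ... | tri< m<n _ _  = R⇒comparable (increasing m<n)
    ... | tri≈ _ refl _ = inj₁ (reflexive ≈.refl)
    ... | tri> _ _ n<m  = Sum.swap (R⇒comparable (increasing n<m))

    Term : Pred Carrier _
    Term x = ∃[ n ] f n ≈ x

    ∧-sel : ∀ {x y} → Term x → Term y → x ∧ y ≈ x ⊎ x ∧ y ≈ y
    ∧-sel (m , fm≈x) (n , fn≈y) = Sum.map
      (λ fm≤fn → ≤⇒∧≈ˡ (≤-respˡ-≈ fm≈x (≤-respʳ-≈ fn≈y fm≤fn)))
      (λ fn≤fm → y≤x⇒x∧y≈y (≤-respˡ-≈ fn≈y (≤-respʳ-≈ fm≈x fn≤fm)))
      (comparable m n)

    terms : MeetSubsemilattice S _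
    terms = record
      { member   = Term
      ; resp     = λ x≈y (n , fn≈x) → n , ≈.trans fn≈x x≈y
      ; ∧-closed = λ x∈ y∈ →
          [ (λ e → proj₁ x∈ , ≈.trans (proj₂ x∈) (≈.sym e))
          , (λ e → proj₁ y∈ , ≈.trans (proj₂ y∈) (≈.sym e)) ] (∧-sel x∈ y∈)
      }

  -- Atoms over an element

  AtomOver : Carrier → Pred Carrier _
  AtomOver x = Maximal (flip _≺_) (x ≺_)

  module _ (em : ExcludedMiddle (c ⊔ ℓ₁ ⊔ ℓ₂)) where
    private
      _≟_ : Decidable _≈_
      _ ≟ _ = lower-em (c ⊔ ℓ₂) em

    atom-minimal : ∀ {x y z} → AtomOver x z → x ≺ y → y ≤ z → y ≈ z
    atom-minimal (_ , minimal) x≺y y≤z =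
      decidable-stable (_ ≟ _) λ y≉z → minimal x≺y (y≤z , y≉z)

    -- Take for `T` the element `x` with all atoms over it. A meet with an atom that is not `x` lies
    -- strictly above `x` and below that atom, hence equals it.
    atoms⇒independent : ∀ {x f} → (∀ n → AtomOver x (f n)) → Injective _≡_ _≈_ f →
      Independent p f
    atoms⇒independent {x = x} {f} atom f-inj =
      irreducible⇒independent star (inj₂ ∘ atom) f-inj irreducible
      where
      Star : Pred Carrier _
      Star y = x ≈ y ⊎ AtomOver x y

      above : ∀ {y} → Star y → x ≤ y
      above (inj₁ x≈y) = reflexive x≈y
      above (inj₂ ((x≤y , _) , _)) = x≤y

      star-resp : ∀ {y z} → y ≈ z → Star y → Star z
      star-resp y≈z (inj₁ x≈y) = inj₁ (≈.trans x≈y y≈z)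
      star-resp y≈z (inj₂ ((x≤y , x≉y) , minimal)) = inj₂
        ( (≤-respʳ-≈ y≈z x≤y , λ x≈z → x≉y (≈.trans x≈z (≈.sym y≈z)))
        , λ x≺w (w≤z , w≉z) → minimal x≺w
            (≤-respʳ-≈ (≈.sym y≈z) w≤z , λ w≈y → w≉z (≈.trans w≈y y≈z)))

      star : MeetSubsemilattice S _
      star = record
        { member   = Star
        ; resp     = star-resp
        ; ∧-closed = closed
        }
        where
        closed : ∀ {y z} → Star y → Star z → Star (y ∧ z)
        closed {y} {z} (inj₁ x≈y) z∈ =
          inj₁ (≈.trans x≈y (≈.sym (≤⇒∧≈ˡ (≤-respˡ-≈ x≈y (above z∈)))))
        closed {y} {z} y∈@(inj₂ y-atom) z∈ with x ≟ (y ∧ z)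
        ... | yes x≈y∧z = inj₁ x≈y∧z
        ... | no  x≉y∧z = star-resp
          (≈.sym (atom-minimal y-atom (∧-greatest (above y∈) (above z∈) , x≉y∧z) (x∧y≤x y z))) y∈

      irreducible : ∀ n {y z} → Star y → Star z → y ∧ z ≈ f n → y ≈ f n ⊎ z ≈ f n
      irreducible n {y} {z} (inj₁ x≈y) z∈ y∧z≈fn = inj₁ (≈.trans
        (≈.sym (≤⇒∧≈ˡ (≤-respˡ-≈ x≈y (above z∈)))) y∧z≈fn)
      irreducible n {y} {z} (inj₂ y-atom) _ y∧z≈fn = inj₁ (≈.sym
        (atom-minimal y-atom (proj₁ (atom n)) (≤-respˡ-≈ y∧z≈fn (x∧y≤x y z))))

    private
      S-setoid = underlyingSetoid S
    open Membership S-setoid using () renaming (_∈_ to _∈ₗ_)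

    module _ (¬descending : ¬ ∃ (Ascending (flip _≺_))) where

      -- Minimality among the elements above `x` and at most `y` is minimality above `x` outright,
      -- since whatever is below `z` is below `y`.
      atom-below : ∀ {x y} → x ≺ y → ∃[ z ] AtomOver x z × z ≤ y
      atom-below {x} {y} x≺y
        with z , (x≺z , z≤y) , minimal ←
          ∃-maximal (flip _≺_) (λ z → x ≺ z × z ≤ y) em ¬descending
            (y , x≺y , reflexive ≈.refl) =
        z , (x≺z , λ x≺w w≺z → minimal (x≺w , ≤-trans (proj₁ w≺z) z≤y) w≺z) , z≤y

      -- A minimal `x` is least: `x ∧ y` cannot be strictly below `x`, so it equals `x`.
      least : Carrier → ∃[ x ] ∀ y → x ≤ y
      least x₀ with x , _ , minimal ←
        ∃-maximal (flip _≺_) U em ¬descending (x₀ , _) =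
        x , λ y → ≤-respˡ-≈
          (decidable-stable ((x ∧ y) ≟ x) λ ≉x → minimal _ (x∧y≤x x y , ≉x)) (x∧y≤y x y)

      ¬covered-atoms : ∀ {x} → Maximal _≺_ (λ y → ¬ Covered S-setoid (y ≤_)) x →
        ¬ Covered S-setoid (AtomOver x)
      ¬covered-atoms {x} (¬covered-x , maximal) (xs , covers) =
        -- Putting `x` itself on the list to avoid makes `y` strictly above `x`.
        let y , x≤y , y∉      = fresh S-setoid (lower-em ℓ₁ em) ¬covered-x (x ∷ concatMap upset xs)
            z , z-atom , z≤y = atom-below (x≤y , λ x≈y → y∉ (here (≈.sym x≈y)))
        in y∉ (there (concat⁺ (map⁺ (Any.map (upset-covers (proj₁ z-atom) z≤y) (covers z-atom)))))
        where
        upset : Carrier → List Carrier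
        upset w with em {Covered S-setoid (w ≤_)}
        ... | yes (ys , _) = ys
        -- A default that no atom over `x` meets: by maximality of `x`, everything strictly above
        -- `x` has a covered up-set.
        ... | no  _        = []

        upset-covers : ∀ {w y z} → x ≺ z → z ≤ y → z ≈ w → y ∈ₗ upset w
        upset-covers {w} x≺z z≤y z≈w with em {Covered S-setoid (w ≤_)}
        ... | yes (_ , ys-covers) = ys-covers (≤-respˡ-≈ z≈w z≤y)
        ... | no  ¬covered-w = contradiction
          (≤-respʳ-≈ z≈w (proj₁ x≺z) , λ x≈w → proj₂ x≺z (≈.trans x≈w (≈.sym z≈w)))
          (maximal ¬covered-w)

    infinite⇒independent : Infinite S-setoid → ∃ (Independent p)
    infinite⇒independent infinite
      with em {∃ (Ascending (flip _≺_))} | em {∃ (Ascending _≺_)}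
    ... | yes (f , descending) | _ =
      f , chain⇒independent (flip <-trans) (λ y≺x x≈y → proj₂ y≺x (≈.sym x≈y)) (inj₂ ∘ proj₁) descending
    ... | no _ | yes (f , ascending) =
      f , chain⇒independent <-trans proj₂ (inj₁ ∘ proj₁) ascending
    ... | no ¬descending | no ¬ascending =
      let ¬covered         = infinite ∘ covered⇒finite S-setoid _≟_
          -- An element outside the empty list: `S` is inhabited.
          x₀ , _ , _       = fresh S-setoid (lower-em ℓ₂ em) ¬covered []
          x , x≤           = least ¬descending x₀
          -- The least element `x` has all of `S` as its up-set, so it is a starting point for the
          -- ascent.
          y , y-maximal    = ∃-maximal _≺_ (λ y → ¬ Covered S-setoid (y ≤_)) em ¬ascending
                               (x , λ (xs , covers) → ¬covered (xs , λ _ → covers (x≤ _)))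
          f , atom , f-inj = ¬covered⇒sequence S-setoid em (¬covered-atoms ¬descending y-maximal)
      in f , atoms⇒independent atom f-inj

  -- Chains over a finite semilattice

  finite⇒scattered : ExcludedMiddle (c ⊔ ℓ₁ ⊔ p) → Finite (underlyingSetoid S) →
    OrderScattered (Lattice.poset (Sub∧ S p))
  finite⇒scattered {p = p} em (n , S↔Fin) (_ , _ , f , iso) =
    -- Two of the `n + 1` new elements coincide. As `i < j` unfolds to `suc i ≤ j`, the element
    -- `new i` of `A (suc i)` lies in `A j`, which `new j` avoids.
    let i , j , i<j , eq = pigeonhole (ℕ.n<1+n n) (to ∘ new ∘ toℕ)
        new-i≈new-j = ≈.trans (≈.sym (strictlyInverseʳ _))
                        (≈.trans (from-cong eq) (strictlyInverseʳ _))
    in new∉ (toℕ j) (resp (A (toℕ j)) new-i≈new-j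
         (mono (fromℕ-mono-≤ i<j) (new∈ (toℕ i))))
    where
    open Inverse S↔Fin using (to; from-cong; strictlyInverseʳ)
    open IsOrderIsomorphism iso using (mono; cancel)
    A : ℕ → MeetSubsemilattice S (c ⊔ ℓ₁ ⊔ p)
    A k = proj₁ (f (fromℕ k))
    -- With nothing new, `A (suc k)` would be included in `A k`, and cancelling the embedding would
    -- give `k + 1 ≤ k`.
    growth : ∀ k → ∃[ x ] x ∈ member (A (suc k)) × ¬ x ∈ member (A k)
    growth k = em⇒dne em λ none →
      ℕ.1+n≰n (fromℕ-cancel-≤ (cancel {fromℕ (suc k)} {fromℕ k}
        λ x∈ → em⇒dne em λ x∉ → none (_ , x∈ , x∉)))
    new : ℕ → Carrier
    new k = proj₁ (growth k)
    new∈ : ∀ k → new k ∈ member (A (suc k))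
    new∈ k = proj₁ (proj₂ (growth k))
    new∉ : ∀ k → ¬ new k ∈ member (A k)
    new∉ k = proj₂ (proj₂ (growth k))

theorem6p1 : ∀ {c ℓ₁ ℓ₂ : Level} (p : Level) → ExcludedMiddle (c ⊔ ℓ₁ ⊔ ℓ₂ ⊔ p) →
    (S : MeetSemilattice c ℓ₁ ℓ₂) →
    (Infinite (underlyingSetoid S) → ContainsChainℚ (Lattice.poset (Sub∧ S p)))
    × (OrderScattered (Lattice.poset (Sub∧ S p)) ⇔ Finite (underlyingSetoid S))
theorem6p1 {c} {ℓ₁} {ℓ₂} p em S =
  infinite⇒chain ,
  -- `Infinite` is the negation of `Finite`, so scatteredness gives the double negation of
  -- finiteness.
  mk⇔ (λ scattered → em⇒dne (lower-em (ℓ₂ ⊔ p) em) (scattered ∘ infinite⇒chain))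
      (finite⇒scattered S {p = p} (lower-em ℓ₂ em))
  where
  infinite⇒chain : Infinite (underlyingSetoid S) → ContainsChainℚ (Lattice.poset (Sub∧ S p))
  infinite⇒chain infinite =
    independent⇒ContainsChainℚ S {p = p} (proj₂ (infinite⇒independent S (lower-em p em) infinite))
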